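{- (Type preservation for DTT.) If $G;\Gamma\vdash t:p\,A@n$ and $t\rightsquigarrow t'$, then $G;\Gamma\vdash t':p\,A@n$.
   Context: **Syntax of DTT.** Polarities are $p\in\{+,-\}$, with $\bar{+}=-$ and $\bar{ - }=+$. Types: $A,B ::= \langle p\rangle\mid A\to_p B\mid A\wedge_p B$. Terms: $t::= x\mid \mathbf{triv}\mid (t,t')\mid \mathbf{in}_d\,t\mid \lambda x.t\mid \langle t,t'\rangle\mid \nu x.t\bullet t'$ with $d\in\{1,2\}$; $\lambda x$ binds $x$ in $t$, and $\nu x$ binds $x$ in both $t$ and $t'$. Terms are identified up to renaming of bound variables. Canonical terms: $c::=x\mid\mathbf{triv}\mid(t,t')\mid\mathbf{in}_d\,t\mid\lambda x.t\mid\langle t,t'\rangle$ (i.e. every term not of the form $\nu x.t\bullet t'$). Graphs $G$ are finite lists of edges $n\preccurlyeq_p n'$ between nodes; contexts $\Gamma$ are finite lists of declarations $x:p\,A@n$, with distinct variables. $|G|,|\Gamma|$ are the lists of nodes occurring in them. **Reachability** $G\vdash n\preccurlyeq^*_p n'$ is inductively generated by: $G,n\preccurlyeq_p n',G'\vdash n\preccurlyeq^*_p n'$; $G\vdash n\preccurlyeq^*_p n$; from $G\vdash n\preccurlyeq^*_p n'$ and $G\vdash n'\preccurlyeq^*_p n''$ infer $G\vdash n\preccurlyeq^*_p n''$; from $G\vdash n'\preccurlyeq^*_{\bar p} n$ infer $G\vdash n\preccurlyeq^*_p n'$. **Typing rules.** (Ax) from $G\vdash n\preccurlyeq^*_p n'$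 infer $G;\Gamma,x:p\,A@n,\Gamma'\vdash x:p\,A@n'$. (Unit) $G;\Gamma\vdash\mathbf{triv}:p\,\langle p\rangle@n$. (And) from $G;\Gamma\vdash t_1:p\,A@n$ and $G;\Gamma\vdash t_2:p\,B@n$ infer $G;\Gamma\vdash(t_1,t_2):p\,(A\wedge_pB)@n$. (AndBar) from $G;\Gamma\vdash t:p\,A_d@n$ infer $G;\Gamma\vdash\mathbf{in}_d\,t:p\,(A_1\wedge_{\bar p}A_2)@n$. (Imp) if $n'\notin|G|,|\Gamma|$, from $(G,n\preccurlyeq_pn');\Gamma,x:p\,A@n'\vdash t:p\,B@n'$ infer $G;\Gamma\vdash\lambda x.t:p\,(A\to_pB)@n$. (ImpBar) from $G\vdash n\preccurlyeq^*_{\bar p}n'$, $G;\Gamma\vdash t_1:\bar p\,A@n'$ and $G;\Gamma\vdash t_2:p\,B@n'$ infer $G;\Gamma\vdash\langle t_1,t_2\rangle:p\,(A\to_{\bar p}B)@n$. (Cut) from $G;\Gamma,x:\bar p\,A@n\vdash t_1:+\,B@n'$ and $G;\Gamma,x:\bar p\,A@n\vdash t_2:-\,B@n'$ infer $G;\Gamma\vdash\nu x.t_1\bullet t_2:p\,A@n$. **Reduction** $\rightsquigarrow$ is the one-step relation obtained by applying the following rules anywhere inside a term (substitution is capture-avoiding): (RImp) $\nu z.\lambda x.t\bullet\langle t_1,t_2\rangle\rightsquigarrow\nu z.[t_1/x]t\bullet t_2$; (RImpBar) $\nu z.\langle t_1,t_2\rangle\bullet\lambda x.t\rightsquigarrow\nu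 z.t_2\bullet[t_1/x]t$; (RAnd$d$) $\nu z.(t_1,t_2)\bullet\mathbf{in}_d\,t\rightsquigarrow\nu z.t_d\bullet t$; (RAndBar$d$) $\nu z.\mathbf{in}_d\,t\bullet(t_1,t_2)\rightsquigarrow\nu z.t\bullet t_d$ (for $d=1,2$); (RRet) $\nu x.t\bullet x\rightsquigarrow t$ if $x\notin\mathrm{FV}(t)$; (RBetaL) $\nu z.(\nu x.t_1\bullet t_2)\bullet t\rightsquigarrow\nu z.[t/x]t_1\bullet[t/x]t_2$; (RBetaR) $\nu z.c\bullet(\nu x.t_1\bullet t_2)\rightsquigarrow\nu z.[c/x]t_1\bullet[c/x]t_2$ for $c$ canonical. -}

module Defs where

open import Data.Fin.Base using (Fin; zero; suc; lift)
open import Data.List.Base using (List; []; _∷_; concatMap)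
open import Data.List.Membership.Propositional using (_∈_; _∉_)
open import Data.Nat.Base using (ℕ; suc)
open import Data.Sign.Base using (Sign; +; -; opposite)
open import Data.Vec.Base using (Vec; _∷_; _[_]=_; toList; map)

Polarity : Set
Polarity = Sign

-- Only an infinite supply of nodes with decidable equality is needed; the
-- order and arithmetic of ℕ play no role.
Node : Set
Node = ℕ

infixr 7 _⇒[_]_
infixr 8 _∧[_]_

data Ty : Set where
  ⟪_⟫    : Polarity → Ty
  _⇒[_]_ : Ty → Polarity → Ty → Ty
  _∧[_]_ : Ty → Polarity → Ty → Ty

data Side : Set where
  one two : Side

pick : {A : Set} → Side → A → A → A
pick one a₁ a₂ = a₁
pick two a₁ a₂ = a₂

-- Terms up to renaming of bound variables: well-scoped de Bruijn terms with
-- free variables among k. ν binds index zero in both of its arguments.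
infixr 5 ƛ_
infix  5 ν_•_
infixr 6 in[_]_

data Term (k : ℕ) : Set where
  var     : Fin k → Term k
  triv    : Term k
  ⦅_,_⦆   : Term k → Term k → Term k
  in[_]_  : Side → Term k → Term k
  ƛ_      : Term (suc k) → Term k
  ⟨_,_⟩   : Term k → Term k → Term k
  ν_•_    : Term (suc k) → Term (suc k) → Term k

data Canonical {k : ℕ} : Term k → Set where
  var   : ∀ {x} → Canonical (var x)
  triv  : Canonical triv
  ⦅_,_⦆ : ∀ t₁ t₂ → Canonical ⦅ t₁ , t₂ ⦆
  in[_]_ : ∀ d t → Canonical (in[ d ] t)
  ƛ_    : ∀ t → Canonical (ƛ t)
  ⟨_,_⟩ : ∀ t₁ t₂ → Canonical ⟨ t₁ , t₂ ⟩

rename : ∀ {k l} → (Fin k → Fin l) → Term k → Term l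
rename ρ (var x)       = var (ρ x)
rename ρ triv          = triv
rename ρ ⦅ t₁ , t₂ ⦆   = ⦅ rename ρ t₁ , rename ρ t₂ ⦆
rename ρ (in[ d ] t)   = in[ d ] rename ρ t
rename ρ (ƛ t)         = ƛ rename (lift 1 ρ) t
rename ρ ⟨ t₁ , t₂ ⟩   = ⟨ rename ρ t₁ , rename ρ t₂ ⟩
rename ρ (ν t₁ • t₂)   = ν rename (lift 1 ρ) t₁ • rename (lift 1 ρ) t₂

weaken : ∀ {k} → Term k → Term (suc k)
weaken = rename suc

Subst : ℕ → ℕ → Set
Subst k l = Fin k → Term l

liftₛ : ∀ {k l} → Subst k l → Subst (suc k) (suc l)
liftₛ σ zero    = var zero
liftₛ σ (suc x) = weaken (σ x)

subst : ∀ {k l} → Subst k l → Term k → Term l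
subst σ (var x)       = σ x
subst σ triv          = triv
subst σ ⦅ t₁ , t₂ ⦆   = ⦅ subst σ t₁ , subst σ t₂ ⦆
subst σ (in[ d ] t)   = in[ d ] subst σ t
subst σ (ƛ t)         = ƛ subst (liftₛ σ) t
subst σ ⟨ t₁ , t₂ ⟩   = ⟨ subst σ t₁ , subst σ t₂ ⟩
subst σ (ν t₁ • t₂)   = ν subst (liftₛ σ) t₁ • subst (liftₛ σ) t₂

single : ∀ {k} → Term k → Subst (suc k) k
single s zero    = s
single s (suc x) = var x

-- [ s /0] t is [s/x]t for x the most recently bound variable.
infix 9 [_/0]_

[_/0]_ : ∀ {k} → Term k → Term (suc k) → Term k
[ s /0] t = subst (single s) t

infix 4 _≼[_]_

data Edge : Set where
  _≼[_]_ : Node → Polarity → Node → Edge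

Graph : Set
Graph = List Edge

infix 4 _∙_＠_

data Decl : Set where
  _∙_＠_ : Polarity → Ty → Node → Decl

-- Contexts grow on the left: the head declares de Bruijn index zero.
Ctx : ℕ → Set
Ctx k = Vec Decl k

graphNodes : Graph → List Node
graphNodes = concatMap λ { (n ≼[ p ] n′) → n ∷ n′ ∷ [] }

declNode : Decl → Node
declNode (p ∙ A ＠ n) = n

ctxNodes : ∀ {k} → Ctx k → List Node
ctxNodes Γ = toList (map declNode Γ)

infix 3 _⊢_≼*[_]_

data _⊢_≼*[_]_ (G : Graph) : Node → Polarity → Node → Set where
  edge  : ∀ {p n n′} → (n ≼[ p ] n′) ∈ G → G ⊢ n ≼*[ p ] n′
  refl  : ∀ {p n} → G ⊢ n ≼*[ p ] n
  trans : ∀ {p n n′ n″} →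
          G ⊢ n ≼*[ p ] n′ → G ⊢ n′ ≼*[ p ] n″ → G ⊢ n ≼*[ p ] n″
  flip  : ∀ {p n n′} → G ⊢ n′ ≼*[ opposite p ] n → G ⊢ n ≼*[ p ] n′

infix 3 _⨾_⊢_∶_

data _⨾_⊢_∶_ (G : Graph) {k : ℕ} (Γ : Ctx k) : Term k → Decl → Set where

  Ax     : ∀ {x p A n n′} →
           Γ [ x ]= (p ∙ A ＠ n) →
           G ⊢ n ≼*[ p ] n′ →
           G ⨾ Γ ⊢ var x ∶ p ∙ A ＠ n′

  Unit   : ∀ {p n} →
           G ⨾ Γ ⊢ triv ∶ p ∙ ⟪ p ⟫ ＠ n

  And    : ∀ {t₁ t₂ p A B n} →
           G ⨾ Γ ⊢ t₁ ∶ p ∙ A ＠ n →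
           G ⨾ Γ ⊢ t₂ ∶ p ∙ B ＠ n →
           G ⨾ Γ ⊢ ⦅ t₁ , t₂ ⦆ ∶ p ∙ A ∧[ p ] B ＠ n

  AndBar : ∀ {d t p A₁ A₂ n} →
           G ⨾ Γ ⊢ t ∶ p ∙ pick d A₁ A₂ ＠ n →
           G ⨾ Γ ⊢ in[ d ] t ∶ p ∙ A₁ ∧[ opposite p ] A₂ ＠ n

  Imp    : ∀ {t p A B n n′} →
           n′ ∉ graphNodes G →
           n′ ∉ ctxNodes Γ →
           ((n ≼[ p ] n′) ∷ G) ⨾ ((p ∙ A ＠ n′) ∷ Γ) ⊢ t ∶ p ∙ B ＠ n′ →
           G ⨾ Γ ⊢ ƛ t ∶ p ∙ A ⇒[ p ] B ＠ n

  ImpBar : ∀ {t₁ t₂ p A B n n′} →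
           G ⊢ n ≼*[ opposite p ] n′ →
           G ⨾ Γ ⊢ t₁ ∶ opposite p ∙ A ＠ n′ →
           G ⨾ Γ ⊢ t₂ ∶ p ∙ B ＠ n′ →
           G ⨾ Γ ⊢ ⟨ t₁ , t₂ ⟩ ∶ p ∙ A ⇒[ opposite p ] B ＠ n

  Cut    : ∀ {t₁ t₂ p A B n n′} →
           G ⨾ ((opposite p ∙ A ＠ n) ∷ Γ) ⊢ t₁ ∶ + ∙ B ＠ n′ →
           G ⨾ ((opposite p ∙ A ＠ n) ∷ Γ) ⊢ t₂ ∶ - ∙ B ＠ n′ →
           G ⨾ Γ ⊢ ν t₁ • t₂ ∶ p ∙ A ＠ n

infix 3 _⇝_

data _⇝_ {k : ℕ} : Term k → Term k → Set where

  RImp    : ∀ {t t₁ t₂} → ν (ƛ t) • ⟨ t₁ , t₂ ⟩ ⇝ ν [ t₁ /0] t • t₂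
  RImpBar : ∀ {t t₁ t₂} → ν ⟨ t₁ , t₂ ⟩ • (ƛ t) ⇝ ν t₂ • [ t₁ /0] t
  RAnd    : ∀ d {t t₁ t₂} → ν ⦅ t₁ , t₂ ⦆ • (in[ d ] t) ⇝ ν pick d t₁ t₂ • t
  RAndBar : ∀ d {t t₁ t₂} → ν (in[ d ] t) • ⦅ t₁ , t₂ ⦆ ⇝ ν t • pick d t₁ t₂
  -- The terms without index zero free are exactly those of the form weaken t.
  RRet    : ∀ {t} → ν weaken t • var zero ⇝ t
  RBetaL  : ∀ {t₁ t₂ t} →
            ν (ν t₁ • t₂) • t ⇝ ν [ t /0] t₁ • [ t /0] t₂
  RBetaR  : ∀ {c t₁ t₂} → Canonical c →
            ν c • (ν t₁ • t₂) ⇝ ν [ c /0] t₁ • [ c /0] t₂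

  pair₁   : ∀ {t₁ t₁′ t₂} → t₁ ⇝ t₁′ → ⦅ t₁ , t₂ ⦆ ⇝ ⦅ t₁′ , t₂ ⦆
  pair₂   : ∀ {t₁ t₂ t₂′} → t₂ ⇝ t₂′ → ⦅ t₁ , t₂ ⦆ ⇝ ⦅ t₁ , t₂′ ⦆
  inj     : ∀ {d t t′} → t ⇝ t′ → in[ d ] t ⇝ in[ d ] t′
  lam     : ∀ {t t′} → t ⇝ t′ → ƛ t ⇝ ƛ t′
  copair₁ : ∀ {t₁ t₁′ t₂} → t₁ ⇝ t₁′ → ⟨ t₁ , t₂ ⟩ ⇝ ⟨ t₁′ , t₂ ⟩
  copair₂ : ∀ {t₁ t₂ t₂′} → t₂ ⇝ t₂′ → ⟨ t₁ , t₂ ⟩ ⇝ ⟨ t₁ , t₂′ ⟩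
  cut₁    : ∀ {t₁ t₁′ t₂} → t₁ ⇝ t₁′ → ν t₁ • t₂ ⇝ ν t₁′ • t₂
  cut₂    : ∀ {t₁ t₂ t₂′} → t₂ ⇝ t₂′ → ν t₁ • t₂ ⇝ ν t₁ • t₂′

{-# OPTIONS --safe #-}

-- Nodes behave like variables of a second sort, so the induction is carried
-- out for a node map f : Node → Node that need only send edges to reachable
-- pairs. Typing is stable under such maps, under moving the node of the
-- conclusion forwards and under moving the nodes of declarations backwards
-- along reachability. Instantiating the eigennode of a λ by the node chosen by
-- the opposing ⟨_,_⟩ types RImp and RImpBar; moving the conclusion (after
-- strengthening) types RRet; the remaining axioms only need substitution.
module Submission where

open import Defs
open import Data.Nat.Base using (ℕ)
open import Data.Bool.Base using (if_then_else_)
open import Data.Fin.Base using (Fin; zero; suc; lift)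
open import Data.List.Base using (List; _∷_; _++_)
open import Data.List.Extrema.Nat using (max; xs≤max)
open import Data.List.Membership.Propositional using (_∈_; _∉_)
open import Data.List.Membership.Propositional.Properties using (∈-++⁺ˡ; ∈-++⁺ʳ)
open import Data.List.Relation.Unary.All as All using ()
open import Data.List.Relation.Unary.Any using (here; there)
open import Data.Nat.Properties using (_≟_; 1+n≰n)
open import Data.Product.Base using (∃-syntax; _×_; _,_)
open import Data.Sign.Base using (+; -; opposite)
open import Data.Vec.Base using (_∷_; _[_]=_; here; there)
open import Function.Base using (id; _∘_)
open import Relation.Binary.PropositionalEquality as ≡ using (_≡_; _≢_; cong; cong₂)
open import Relation.Nullary.Decidable using (does; yes; no; dec-true; dec-false)

private
  variable
    j k l : ℕ
    G G′ : Graph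
    a b m n n₁ n₁′ : Node
    p : Polarity
    A B : Ty

rename-id : {ρ : Fin k → Fin k} → (∀ x → ρ x ≡ x) → ∀ t → rename ρ t ≡ t
rename-id-lift : {ρ : Fin k → Fin k} → (∀ x → ρ x ≡ x) →
                 ∀ t → rename (lift 1 ρ) t ≡ t

rename-id ρ-id (var x)     = cong var (ρ-id x)
rename-id ρ-id triv        = ≡.refl
rename-id ρ-id ⦅ t₁ , t₂ ⦆ = cong₂ ⦅_,_⦆ (rename-id ρ-id t₁) (rename-id ρ-id t₂)
rename-id ρ-id (in[ d ] t) = cong in[ d ]_ (rename-id ρ-id t)
rename-id ρ-id (ƛ t)       = cong ƛ_ (rename-id-lift ρ-id t)
rename-id ρ-id ⟨ t₁ , t₂ ⟩ = cong₂ ⟨_,_⟩ (rename-id ρ-id t₁) (rename-id ρ-id t₂)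
rename-id ρ-id (ν t₁ • t₂) = cong₂ ν_•_ (rename-id-lift ρ-id t₁) (rename-id-lift ρ-id t₂)

rename-id-lift ρ-id = rename-id λ { zero → ≡.refl ; (suc x) → cong suc (ρ-id x) }

fresh : ∀ (xs ys : List Node) → ∃[ n ] n ∉ xs × n ∉ ys
fresh xs ys = ℕ.suc (max 0 (xs ++ ys)) , bound∉ ∘ ∈-++⁺ˡ , bound∉ ∘ ∈-++⁺ʳ xs
  where
  bound∉ : ℕ.suc (max 0 (xs ++ ys)) ∉ xs ++ ys
  bound∉ i = 1+n≰n (All.lookup (xs≤max 0 (xs ++ ys)) i)

source∈graphNodes : (a ≼[ p ] b) ∈ G → a ∈ graphNodes G
source∈graphNodes (here ≡.refl)             = here ≡.refl
source∈graphNodes (there {x = _ ≼[ _ ] _} i) = there (there (source∈graphNodes i))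

target∈graphNodes : (a ≼[ p ] b) ∈ G → b ∈ graphNodes G
target∈graphNodes (here ≡.refl)             = there (here ≡.refl)
target∈graphNodes (there {x = _ ≼[ _ ] _} i) = there (there (target∈graphNodes i))

declNode∈ctxNodes : ∀ {Γ : Ctx k} {x} → Γ [ x ]= (p ∙ A ＠ n) → n ∈ ctxNodes Γ
declNode∈ctxNodes here      = here ≡.refl
declNode∈ctxNodes (there i) = there (declNode∈ctxNodes i)

∈∉⇒≢ : ∀ {xs : List Node} → a ∈ xs → b ∉ xs → a ≢ b
∈∉⇒≢ a∈xs b∉xs ≡.refl = b∉xs a∈xs

≼*-reflexive : a ≡ b → G ⊢ a ≼*[ p ] b
≼*-reflexive ≡.refl = refl

≼*-sym : G ⊢ a ≼*[ p ] b → G ⊢ b ≼*[ opposite p ] a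
-- Splitting on the polarity makes `opposite (opposite p)` compute to `p`.
≼*-sym {p = + } r = flip r
≼*-sym {p = - } r = flip r

GraphMap : (Node → Node) → Graph → Graph → Set
GraphMap f G G′ = ∀ {a p b} → (a ≼[ p ] b) ∈ G → G′ ⊢ f a ≼*[ p ] f b

≼*-map : ∀ {f} → GraphMap f G G′ → G ⊢ a ≼*[ p ] b → G′ ⊢ f a ≼*[ p ] f b
≼*-map φ (edge e)    = φ e
≼*-map φ refl        = refl
≼*-map φ (trans r s) = trans (≼*-map φ r) (≼*-map φ s)
≼*-map φ (flip r)    = flip (≼*-map φ r)

≼*-weaken : ∀ {e} → G ⊢ a ≼*[ p ] b → e ∷ G ⊢ a ≼*[ p ] b
≼*-weaken = ≼*-map (edge ∘ there)

infix 9 _[_↦_]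

_[_↦_] : (Node → Node) → Node → Node → Node → Node
(f [ a ↦ b ]) n = if does (n ≟ a) then b else f n

update-≡ : ∀ f a → (f [ a ↦ b ]) a ≡ b
update-≡ f a rewrite dec-true (a ≟ a) ≡.refl = ≡.refl

update-≢ : ∀ f → n ≢ a → (f [ a ↦ b ]) n ≡ f n
update-≢ {n} {a} f n≢a rewrite dec-false (n ≟ a) n≢a = ≡.refl

-- In (Imp) the eigennode n₁ may coincide with n when n occurs in neither G nor
-- Γ; the new edge is then a loop.
GraphMap-update : ∀ {f} → n₁ ∉ graphNodes G → GraphMap f G G′ →
                  G′ ⊢ f n ≼*[ p ] n₁′ →
                  GraphMap (f [ n₁ ↦ n₁′ ]) ((n ≼[ p ] n₁) ∷ G) G′
GraphMap-update {n₁ = n₁} {n = n} {f = f} n₁∉G φ r (here ≡.refl) with n ≟ n₁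
... | yes ≡.refl = refl
... | no n≢n₁   = trans (≼*-reflexive (update-≢ f n≢n₁))
                         (trans r (≼*-reflexive (≡.sym (update-≡ f n₁))))
-- Both ends of an old edge occur in `G`, so they differ from `n₁` and the update fixes them.
GraphMap-update {f = f} n₁∉G φ r (there e) =
  trans (≼*-reflexive (update-≢ f (∈∉⇒≢ (source∈graphNodes e) n₁∉G)))
  (trans (φ e)
         (≼*-reflexive (≡.sym (update-≢ f (∈∉⇒≢ (target∈graphNodes e) n₁∉G)))))

≼*-update : ∀ f {Γ : Ctx k} {x} → n₁ ∉ ctxNodes Γ → Γ [ x ]= (p ∙ A ＠ a) →
            G ⊢ b ≼*[ p ] f a → G ⊢ b ≼*[ p ] (f [ n₁ ↦ n₁′ ]) a
≼*-update f n₁∉Γ i r =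
  trans r (≼*-reflexive (≡.sym (update-≢ f (∈∉⇒≢ (declNode∈ctxNodes i) n₁∉Γ))))

-- The relation between ρ and ρ′ is a span: it covers weakening (ρ = id) as
-- well as strengthening (ρ′ = id).
CtxMap : (Node → Node) → Graph → (Fin j → Fin k) → Ctx k → (Fin j → Fin l) → Ctx l → Set
CtxMap f G′ ρ Γ ρ′ Γ′ = ∀ x {p A a} → Γ [ ρ x ]= (p ∙ A ＠ a) →
  ∃[ b ] Γ′ [ ρ′ x ]= (p ∙ A ＠ b) × (G′ ⊢ b ≼*[ p ] f a)

CtxMap-lift : ∀ {f} {ρ : Fin j → Fin k} {Γ} {ρ′ : Fin j → Fin l} {Γ′} →
              CtxMap f G′ ρ Γ ρ′ Γ′ → G′ ⊢ b ≼*[ p ] f a →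
              CtxMap f G′ (lift 1 ρ) ((p ∙ A ＠ a) ∷ Γ) (lift 1 ρ′) ((p ∙ A ＠ b) ∷ Γ′)
CtxMap-lift γ r zero    here = _ , here , r
CtxMap-lift γ r (suc x) (there i) with _ , i′ , r′ ← γ x i = _ , there i′ , r′

-- Recursion is on the term: once `t` is a constructor, `rename ρ t` reduces and the derivation can
-- be matched.
⊢-rename : ∀ {f} {ρ : Fin j → Fin k} {Γ} {ρ′ : Fin j → Fin l} {Γ′} (t : Term j) →
           GraphMap f G G′ → CtxMap f G′ ρ Γ ρ′ Γ′ →
           G ⨾ Γ ⊢ rename ρ t ∶ p ∙ A ＠ n → G′ ⊢ f n ≼*[ p ] m →
           G′ ⨾ Γ′ ⊢ rename ρ′ t ∶ p ∙ A ＠ m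
⊢-rename (var x) φ γ (Ax i s) r with _ , i′ , r′ ← γ x i =
  Ax i′ (trans r′ (trans (≼*-map φ s) r))
⊢-rename triv φ γ Unit r = Unit
⊢-rename ⦅ t₁ , t₂ ⦆ φ γ (And d₁ d₂) r =
  And (⊢-rename t₁ φ γ d₁ r) (⊢-rename t₂ φ γ d₂ r)
⊢-rename (in[ _ ] t) φ γ (AndBar d) r = AndBar (⊢-rename t φ γ d r)
-- The old eigennode may occur in `G′` or `Γ′`, so a fresh one is chosen and `f` redirected to it.
-- The old edge is covered by `r` followed by the new edge out of the moved conclusion node.
⊢-rename {G′ = G′} {f = f} {Γ′ = Γ′} (ƛ t) φ γ (Imp {n′ = n₁} n₁∉G n₁∉Γ d) r
  with n₁′ , n₁′∉G′ , n₁′∉Γ′ ← fresh (graphNodes G′) (ctxNodes Γ′) =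
  Imp n₁′∉G′ n₁′∉Γ′
    (⊢-rename t
      (GraphMap-update n₁∉G (≼*-weaken ∘ φ) (trans (≼*-weaken r) (edge (here ≡.refl))))
      (CtxMap-lift
        (λ x i → let _ , i′ , r′ = γ x i in _ , i′ , ≼*-update f n₁∉Γ i (≼*-weaken r′))
        (≼*-reflexive (≡.sym (update-≡ f n₁))))
      d
      (≼*-reflexive (update-≡ f n₁)))
⊢-rename ⟨ t₁ , t₂ ⟩ φ γ (ImpBar s d₁ d₂) r =
  ImpBar (trans (≼*-sym r) (≼*-map φ s)) (⊢-rename t₁ φ γ d₁ refl) (⊢-rename t₂ φ γ d₂ refl)
-- The bound variable sits at the node of the conclusion with opposite polarity, so moving the
-- conclusion forwards moves this declaration backwards. Hence both movements are handled in one
-- induction.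
⊢-rename (ν t₁ • t₂) φ γ (Cut d₁ d₂) r =
  Cut (⊢-rename t₁ φ γ′ d₁ refl) (⊢-rename t₂ φ γ′ d₂ refl)
  where γ′ = CtxMap-lift γ (≼*-sym r)

rename-id-⊢ : ∀ {Γ : Ctx k} {t : Term k} →
              G ⨾ Γ ⊢ rename id t ∶ p ∙ A ＠ n → G ⨾ Γ ⊢ t ∶ p ∙ A ＠ n
rename-id-⊢ {t = t} = ≡.subst (_ ⨾ _ ⊢_∶ _) (rename-id (λ _ → ≡.refl) t)

module _ {Γ : Ctx k} {t : Term k} where

  ⊢-extend : ∀ {ρ : Fin k → Fin l} {Γ′} → GraphMap id G G′ → CtxMap id G′ id Γ ρ Γ′ →
             G ⨾ Γ ⊢ t ∶ p ∙ A ＠ n → G′ ⊢ n ≼*[ p ] m →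
             G′ ⨾ Γ′ ⊢ rename ρ t ∶ p ∙ A ＠ m
  ⊢-extend φ γ d = ⊢-rename {f = id} {ρ = id} t φ γ
    (≡.subst (_ ⨾ _ ⊢_∶ _) (≡.sym (rename-id (λ _ → ≡.refl) t)) d)

  ⊢-≼* : G ⨾ Γ ⊢ t ∶ p ∙ A ＠ n → G ⊢ n ≼*[ p ] m → G ⨾ Γ ⊢ t ∶ p ∙ A ＠ m
  ⊢-≼* d r = rename-id-⊢ (⊢-extend edge (λ _ i → _ , i , refl) d r)

  ⊢-weaken-graph : ∀ {e} → G ⨾ Γ ⊢ t ∶ p ∙ A ＠ n → (e ∷ G) ⨾ Γ ⊢ t ∶ p ∙ A ＠ n
  ⊢-weaken-graph d =
    rename-id-⊢ (⊢-extend (edge ∘ there) (λ _ i → _ , i , refl) d refl)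

  ⊢-weaken : ∀ {D} → G ⨾ Γ ⊢ t ∶ p ∙ A ＠ n → G ⨾ (D ∷ Γ) ⊢ weaken t ∶ p ∙ A ＠ n
  ⊢-weaken d = ⊢-extend edge (λ _ i → _ , there i , refl) d refl

  -- The span is read backwards, with left leg `suc` and right leg `id`: `CtxMap` then asks only
  -- about indices `suc x`, which are declared in `Γ`.
  ⊢-strengthen : ∀ {D} → G ⨾ (D ∷ Γ) ⊢ weaken t ∶ p ∙ A ＠ n → G ⨾ Γ ⊢ t ∶ p ∙ A ＠ n
  ⊢-strengthen d = rename-id-⊢
    (⊢-rename {f = id} {ρ′ = id} t edge (λ { _ (there i) → _ , i , refl }) d refl)

SubstMap : (Node → Node) → Graph → Ctx k → Subst k l → Ctx l → Set
SubstMap f G′ Γ σ Γ′ = ∀ {x p A a} → Γ [ x ]= (p ∙ A ＠ a) →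
  ∃[ b ] (G′ ⨾ Γ′ ⊢ σ x ∶ p ∙ A ＠ b) × (G′ ⊢ b ≼*[ p ] f a)

SubstMap-lift : ∀ {f} {Γ : Ctx k} {σ} {Γ′ : Ctx l} →
                SubstMap f G′ Γ σ Γ′ → G′ ⊢ b ≼*[ p ] f a →
                SubstMap f G′ ((p ∙ A ＠ a) ∷ Γ) (liftₛ σ) ((p ∙ A ＠ b) ∷ Γ′)
SubstMap-lift γ r here = _ , Ax here refl , r
SubstMap-lift γ r (there i) with _ , d , r′ ← γ i = _ , ⊢-weaken d , r′

⊢-subst : ∀ {f} {Γ : Ctx k} {σ} {Γ′ : Ctx l} {t} →
          GraphMap f G G′ → SubstMap f G′ Γ σ Γ′ →
          G ⨾ Γ ⊢ t ∶ p ∙ A ＠ n → G′ ⊢ f n ≼*[ p ] m →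
          G′ ⨾ Γ′ ⊢ subst σ t ∶ p ∙ A ＠ m
-- The substituted term is typed at an earlier node and is carried along the whole path to `m`.
⊢-subst φ γ (Ax i s) r with _ , d , r′ ← γ i = ⊢-≼* d (trans r′ (trans (≼*-map φ s) r))
⊢-subst φ γ Unit r = Unit
⊢-subst φ γ (And d₁ d₂) r = And (⊢-subst φ γ d₁ r) (⊢-subst φ γ d₂ r)
⊢-subst φ γ (AndBar d) r = AndBar (⊢-subst φ γ d r)
⊢-subst {G′ = G′} {f = f} {Γ′ = Γ′} φ γ (Imp {n′ = n₁} n₁∉G n₁∉Γ d) r
  with n₁′ , n₁′∉G′ , n₁′∉Γ′ ← fresh (graphNodes G′) (ctxNodes Γ′) =
  Imp n₁′∉G′ n₁′∉Γ′
    (⊢-subst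
      (GraphMap-update n₁∉G (≼*-weaken ∘ φ) (trans (≼*-weaken r) (edge (here ≡.refl))))
      (SubstMap-lift
        -- The substituted terms are typed over `G′` and must follow it into the graph with the new
        -- edge.
        (λ i → let _ , e , r′ = γ i in
               _ , ⊢-weaken-graph e , ≼*-update f n₁∉Γ i (≼*-weaken r′))
        (≼*-reflexive (≡.sym (update-≡ f n₁))))
      d
      (≼*-reflexive (update-≡ f n₁)))
⊢-subst φ γ (ImpBar s d₁ d₂) r =
  ImpBar (trans (≼*-sym r) (≼*-map φ s)) (⊢-subst φ γ d₁ refl) (⊢-subst φ γ d₂ refl)
⊢-subst φ γ (Cut d₁ d₂) r = Cut (⊢-subst φ γ′ d₁ refl) (⊢-subst φ γ′ d₂ refl)
  where
  γ′ : SubstMap _ _ _ _ _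
  γ′ = SubstMap-lift γ (≼*-sym r)

module _ {Γ : Ctx k} {s : Term k} {t : Term (ℕ.suc k)} where

  ⊢-single : ∀ {q} → G ⨾ Γ ⊢ s ∶ q ∙ B ＠ m → G ⨾ ((q ∙ B ＠ m) ∷ Γ) ⊢ t ∶ p ∙ A ＠ n →
             G ⨾ Γ ⊢ [ s /0] t ∶ p ∙ A ＠ n
  ⊢-single e d = ⊢-subst edge
    (λ { here → _ , e , refl ; (there i) → _ , Ax i refl , refl }) d refl

  -- The node map is the identity except that `n₁` goes to `m`. Freshness keeps `G` and `Γ` fixed,
  -- and `r` justifies the edge added by the binder.
  ⊢-instantiate : n₁ ∉ graphNodes G → n₁ ∉ ctxNodes Γ →
                  ((n ≼[ p ] n₁) ∷ G) ⨾ ((p ∙ A ＠ n₁) ∷ Γ) ⊢ t ∶ p ∙ B ＠ n₁ →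
                  G ⊢ n ≼*[ p ] m → G ⨾ Γ ⊢ s ∶ p ∙ A ＠ m →
                  G ⨾ Γ ⊢ [ s /0] t ∶ p ∙ B ＠ m
  ⊢-instantiate {n₁ = n₁} n₁∉G n₁∉Γ d r e = ⊢-subst
    (GraphMap-update n₁∉G edge r)
    (λ { here      → _ , e , ≼*-reflexive (≡.sym (update-≡ id n₁))
       ; (there i) → _ , Ax i refl , ≼*-update id n₁∉Γ i refl })
    d
    (≼*-reflexive (update-≡ id n₁))

-- The reduction comes first: RRet has the non-constructor index weaken t, so it
-- must be split on before the typing derivation.
preservation : ∀ {Γ : Ctx k} {t t′ : Term k} →
               t ⇝ t′ → G ⨾ Γ ⊢ t ∶ p ∙ A ＠ n → G ⨾ Γ ⊢ t′ ∶ p ∙ A ＠ n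
-- The new cut is formed at the node and codomain type supplied by the `ImpBar` premises.
preservation RImp (Cut (Imp n₁∉G n₁∉Γ d) (ImpBar r e₁ e₂)) =
  Cut (⊢-instantiate n₁∉G n₁∉Γ d r e₁) e₂
preservation RImpBar (Cut (ImpBar r e₁ e₂) (Imp n₁∉G n₁∉Γ d)) =
  Cut e₂ (⊢-instantiate n₁∉G n₁∉Γ d r e₁)
-- Splitting on the side reduces `pick` in the term and in the type at once.
preservation (RAnd one) (Cut (And d₁ d₂) (AndBar d)) = Cut d₁ d
preservation (RAnd two) (Cut (And d₁ d₂) (AndBar d)) = Cut d₂ d
preservation (RAndBar one) (Cut (AndBar d) (And d₁ d₂)) = Cut d d₁
preservation (RAndBar two) (Cut (AndBar d) (And d₁ d₂)) = Cut d d₂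
-- `Ax` gives a path from `n` to the cut node at polarity `-`; flipped, it brings `t` back to `n`.
preservation {p = + } RRet (Cut d (Ax here r)) = ⊢-≼* (⊢-strengthen d) (flip r)
-- Here index zero is declared at `+`, but the right side of a cut has polarity `-`.
preservation {p = - } RRet (Cut d (Ax () r))
-- The inner cut declares its variable with exactly the polarity, type and node of the opposing
-- term.
preservation RBetaL (Cut (Cut d₁ d₂) d) = Cut (⊢-single d d₁) (⊢-single d d₂)
preservation (RBetaR _) (Cut d (Cut d₁ d₂)) = Cut (⊢-single d d₁) (⊢-single d d₂)
preservation (pair₁ s) (And d₁ d₂) = And (preservation s d₁) d₂
preservation (pair₂ s) (And d₁ d₂) = And d₁ (preservation s d₂)
preservation (inj s) (AndBar d) = AndBar (preservation s d)
preservation (lam s) (Imp n₁∉G n₁∉Γ d) = Imp n₁∉G n₁∉Γ (preservation s d)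
preservation (copair₁ s) (ImpBar r d₁ d₂) = ImpBar r (preservation s d₁) d₂
preservation (copair₂ s) (ImpBar r d₁ d₂) = ImpBar r d₁ (preservation s d₂)
preservation (cut₁ s) (Cut d₁ d₂) = Cut (preservation s d₁) d₂
preservation (cut₂ s) (Cut d₁ d₂) = Cut d₁ (preservation s d₂)

lemma6p6 : ∀ {k : ℕ} {G : Graph} {Γ : Ctx k} {t t′ : Term k} {p : Polarity} {A : Ty} {n : Node} →
    G ⨾ Γ ⊢ t ∶ p ∙ A ＠ n → t ⇝ t′ → G ⨾ Γ ⊢ t′ ∶ p ∙ A ＠ n
lemma6p6 d s = preservation s d
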